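{- Let $s(q)\neq 0$. The sequences $$a=\left(L^*_{2n}(x,-s(q),q)\,s(q)^{ -n}\right)_{n\ge 0},\qquad b=\left(\frac{x^{2n}}{s(q)^n\,(q;q)_{2n}}\right)_{n\ge 0}$$ form a Bailey pair with $m=0$, and the sequences $$a=\left(L^*_{2n+1}(x,-s(q),q)\,s(q)^{ -n}\right)_{n\ge 0},\qquad b=\left(\frac{x^{2n+1}}{s(q)^n\,(q;q)_{2n+1}}\right)_{n\ge 0}$$ form a Bailey pair with $m=1$.
   Context: Here $x$ and $q$ are indeterminates and $s(q)$ is an arbitrary nonzero quantity, possibly depending on $q$ (e.g. a nonzero rational function of $q$). Write $(z;q)_n=\prod_{j=0}^{n-1}(1-q^jz)$, $\begin{bmatrix} n\\ k\end{bmatrix}=\dfrac{(q;q)_n}{(q;q)_k(q;q)_{n-k}}$ for $0\le k\le n$ (and $0$ otherwise), $[n]=\frac{1-q^n}{1-q}$. For $m\in\{0,1\}$, two sequences $a=(\alpha_n)_{n\ge0}$ and $b=(\beta_n)_{n\ge0}$ are called a Bailey pair (with parameter $m$) if for all $n\ge 0$ $$\beta_n=\sum_{k=0}^n\frac{\alpha_k}{(q;q)_{n-k}(q;q)_{n+k+m}}.$$ The classical Lucas polynomials are given by $L_0(x,s)=2$, $L_1(x,s)=x$, $L_n(x,s)=xL_{n-1}(x,s)+sL_{n-2}(x,s)$. Let $D$ be the $q$-differentiation operator $Df(x)=\dfrac{f(x)-f(qx)}{(1-q)x}$. The $q$-Lucas polynomials are $L_n(x,s,q)=L_n\big(x+(q-1)sD,s\big)1$,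 i.e. the operator obtained by substituting $x+(q-1)sD$ for $x$ (with $x$ acting as multiplication), applied to the constant polynomial $1$. Explicitly, for $n>0$, $$L_n(x,s,q)=\sum_{k=0}^{\lfloor n/2\rfloor} q^{\binom k2}\frac{[n]}{[n-k]}\begin{bmatrix} n-k\\ k\end{bmatrix}s^kx^{n-2k}.$$ Finally $L_n^*(x,s,q)=L_n(x,s,q)$ for $n>0$ and $L_0^*(x,s,q)=1$; $L^*_n(x,-s(q),q)$ means $s$ is replaced by $-s(q)$. -}

module Defs where

open import Algebra.Apartness.Bundles using (HeytingCommutativeRing; HeytingField)
open import Algebra.Bundles using (CommutativeRing; RawMonoid; Semiring)
import Algebra.Apartness.Properties.HeytingCommutativeRing as HCRProperties
import Algebra.Definitions.RawMonoid as RawMonoidDefs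
import Algebra.Definitions.RawSemiring as RawSemiringDefs
open import Data.Fin.Base using (Fin; zero; suc; toℕ)
open import Data.List.Base using (List; []; _∷_; map; drop)
open import Data.Nat.Base as ℕ using (ℕ; zero; suc; _∸_)
open import Data.Product.Base using (_,_; proj₁)

-- The scalars form an arbitrary (Heyting) field K; "nonzero" is apartness
-- from 0#, which is the same as invertibility.
module Field {c ℓ₁ ℓ₂} (K : HeytingField c ℓ₁ ℓ₂) where

  open HeytingField K hiding (zero)
  open HCRProperties heytingCommutativeRing using (1#0; x-0≈x; invertibleˡ⇒#)
  open HCRProperties heytingCommutativeRing using (x#0y#0→xy#0) public
  open CommutativeRing (HeytingCommutativeRing.commutativeRing heytingCommutativeRing)
    using (semiring)
  open Semiring semiring using (rawSemiring)
  open RawSemiringDefs rawSemiring using (_^_; product) public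

  inv : (x : Carrier) → x # 0# → Carrier
  inv x x#0 = proj₁ (#⇒invertible x#0)

  x#y→x-y#0 : ∀ {x y} → x # y → x - y # 0#
  x#y→x-y#0 x#y with #⇒invertible x#y
  ... | z , z*[x-y]≈1 , _ =
    invertibleˡ⇒# (z , trans (*-congˡ (x-0≈x _)) z*[x-y]≈1)

  ^#0 : ∀ {x} → x # 0# → ∀ n → x ^ n # 0#
  ^#0 x#0 zero    = 1#0
  ^#0 x#0 (suc n) = x#0y#0→xy#0 x#0 (^#0 x#0 n)

  product#0 : ∀ {n} (f : Fin n → Carrier) → (∀ i → f i # 0#) → product f # 0#
  product#0 {zero}  f f#0 = 1#0
  product#0 {suc n} f f#0 =
    x#0y#0→xy#0 (f#0 zero) (product#0 (λ i → f (suc i)) (λ i → f#0 (suc i)))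

  -- All that is used of an indeterminate q: every 1 - qⁿ with n ≥ 1 is
  -- nonzero.  An indeterminate q, in K = k(q), is an instance.
  NotRootOfUnity : Carrier → Set ℓ₂
  NotRootOfUnity q = ∀ n → q ^ suc n # 1#

  -- (z;q)ₙ
  poch : Carrier → Carrier → ℕ → Carrier
  poch z q n = product {n} (λ j → 1# - q ^ toℕ j * z)

-- Polynomials in the indeterminate x over K: coefficient lists, constant term
-- first; trailing zeros are allowed, so equality is coefficientwise.
module Polynomials {c ℓ₁ ℓ₂} (K : HeytingField c ℓ₁ ℓ₂) where

  open HeytingField K hiding (zero)
  open Field K

  Poly : Set c
  Poly = List Carrier

  coeff : Poly → ℕ → Carrier
  coeff []      _       = 0#
  coeff (a ∷ f) zero    = a
  coeff (a ∷ f) (suc i) = coeff f i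

  infix 4 _≈ₚ_
  _≈ₚ_ : Poly → Poly → Set ℓ₁
  f ≈ₚ g = ∀ i → coeff f i ≈ coeff g i

  infixl 6 _+ₚ_ _-ₚ_
  _+ₚ_ : Poly → Poly → Poly
  []      +ₚ g       = g
  (a ∷ f) +ₚ []      = a ∷ f
  (a ∷ f) +ₚ (b ∷ g) = a + b ∷ f +ₚ g

  _-ₚ_ : Poly → Poly → Poly
  f -ₚ g = f +ₚ map -_ g

  infixr 7 _•_
  _•_ : Carrier → Poly → Poly
  a • f = map (a *_) f

  infix 7 _÷_⟦_⟧
  _÷_⟦_⟧ : Poly → (a : Carrier) → a # 0# → Poly
  f ÷ a ⟦ a#0 ⟧ = inv a a#0 • f

  const : Carrier → Poly
  const a = a ∷ []

  x·_ : Poly → Poly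
  x· f = 0# ∷ f

  x^_ : ℕ → Poly
  x^ zero  = const 1#
  x^ suc n = x· (x^ n)

  -- f(qx)
  dilate : Carrier → Poly → Poly
  dilate q []      = []
  dilate q (a ∷ f) = a ∷ q • dilate q f

  -- Division by x; exact on polynomials whose constant term is zero.
  _/x : Poly → Poly
  f /x = drop 1 f

  polyRawMonoid : RawMonoid c ℓ₁
  polyRawMonoid = record { Carrier = Poly ; _≈_ = _≈ₚ_ ; _∙_ = _+ₚ_ ; ε = [] }

  open RawMonoidDefs polyRawMonoid using () renaming (sum to sumₚ) public

  -- p ⟨ T ⟩ is the operator p(T) obtained by substituting the operator T for
  -- x in p = Σ aᵢ xⁱ, i.e. f ↦ Σ aᵢ Tⁱ f, in Horner form.
  _⟨_⟩ : Poly → (Poly → Poly) → (Poly → Poly)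
  ([]      ⟨ T ⟩) f = []
  ((a ∷ p) ⟨ T ⟩) f = a • f +ₚ T ((p ⟨ T ⟩) f)

  lucas : ℕ → Carrier → Poly
  lucas 0             s = const (1# + 1#)
  lucas 1             s = x^ 1
  lucas (suc (suc n)) s = x· lucas (suc n) s +ₚ s • lucas n s

module QSeries {c ℓ₁ ℓ₂} (K : HeytingField c ℓ₁ ℓ₂)
               (q : HeytingField.Carrier K)
               (q-nru : Field.NotRootOfUnity K q) where

  open HeytingField K hiding (zero)
  open HCRProperties heytingCommutativeRing using (#-congˡ; #-congʳ)
  open Field K
  open Polynomials K

  1-q#0 : 1# - q # 0#
  1-q#0 = x#y→x-y#0 (#-sym (#-congʳ (*-identityʳ q) (q-nru 0)))

  -- (q;q)ₙ; its factors are the 1 - qⁿ with n ≥ 1.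
  qq : ℕ → Carrier
  qq = poch q q

  qq#0 : ∀ n → qq n # 0#
  qq#0 n = product#0 {n} _ λ j →
    x#y→x-y#0 (#-congˡ (*-comm q (q ^ toℕ j)) (#-sym (q-nru (toℕ j))))

  D : Poly → Poly
  D f = ((f -ₚ dilate q f) /x) ÷ (1# - q) ⟦ 1-q#0 ⟧

  x+[q-1]_D : Carrier → Poly → Poly
  (x+[q-1] s D) f = x· f +ₚ ((q - 1#) * s) • D f

  qLucas : ℕ → Carrier → Poly
  qLucas n s = (lucas n s ⟨ x+[q-1] s D ⟩) (const 1#)

  qLucas* : ℕ → Carrier → Poly
  qLucas* zero    s = const 1#
  qLucas* (suc n) s = qLucas (suc n) s

  BaileyPair : ℕ → (ℕ → Poly) → (ℕ → Poly) → Set ℓ₁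
  BaileyPair m α β = ∀ n →
    β n ≈ₚ sumₚ {suc n} λ i → let k = toℕ i in
      α k ÷ qq (n ∸ k) * qq (n ℕ.+ k ℕ.+ m)
            ⟦ x#0y#0→xy#0 (qq#0 (n ∸ k)) (qq#0 (n ℕ.+ k ℕ.+ m)) ⟧

{-# OPTIONS --safe #-}

-- With T = x + (1-q)sD one has T xⁿ = xⁿ⁺¹ + s(1-qⁿ)xⁿ⁻¹ and T Lₙ = Lₙ₊₁ + s Lₙ₋₁.  Hence
-- bₙ = xⁿ/(q;q)ₙ satisfies (1-qⁿ⁺¹) bₙ₊₁ = T bₙ - s bₙ₋₁, the recurrence of the continuous
-- q-Hermite polynomials in T.  The sum Σⱼ sʲ L*ₙ₋₂ⱼ / ((q;q)ⱼ (q;q)ₙ₋ⱼ) satisfies the same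
-- recurrence, because (1-qᵃ⁺ᵇ) + (1-qᵃ)(1-qᵇ) = (1-qᵃ) + (1-qᵇ); the doubled term
-- T L₁ = L₂ + 2s L*₀ is matched by the symmetry of the coefficients.  Even and odd n give
-- the two Bailey pairs.
module Submission where

open import Defs
open import Algebra.Apartness.Bundles using (HeytingField; HeytingCommutativeRing)
open import Algebra.Bundles using (CommutativeRing)
import Algebra.Apartness.Properties.HeytingCommutativeRing as HCRProperties
import Algebra.Properties.Monoid.Sum as MonoidSum
import Algebra.Properties.Ring as RingProperties
import Algebra.Properties.Semiring.Exp as Exp
import Algebra.Properties.Semiring.Sum as SemiringSum
import Algebra.Solver.Ring.NaturalCoefficients.Default as NaturalCoefficients
open import Data.Fin.Base using (Fin; zero; suc; toℕ)
open import Data.Fin.Properties using (toℕ<n; toℕ-inject₁; toℕ-fromℕ)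
open import Data.List.Base using ([]; _∷_; map)
open import Data.Nat.Base as ℕ using (ℕ; zero; suc; _∸_; _≤_; z≤n; s≤s; s≤s⁻¹)
import Data.Nat.Properties as ℕ
open import Data.Product.Base using (_×_; _,_; proj₂)
open import Function.Base using (_∘_)
open import Relation.Binary.PropositionalEquality as ≡ using (_≡_)
import Relation.Binary.Reasoning.Setoid as SetoidReasoning

-- Inverses and finite sums over a Heyting field.

module FieldProperties {c ℓ₁ ℓ₂} (K : HeytingField c ℓ₁ ℓ₂) where

  open HeytingField K hiding (zero)
  open HCRProperties heytingCommutativeRing using (x-0≈x)
  open CommutativeRing (HeytingCommutativeRing.commutativeRing heytingCommutativeRing) public
    using (commutativeSemiring; semiring; ring; *-monoid)
  open SemiringSum semiring public using (sum; sum-cong-≋; ∑-distrib-+; *-distribˡ-sum)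
  open Field K
  open SetoidReasoning setoid
  open NaturalCoefficients commutativeSemiring public
    using (solve; _:+_; _:*_; _:=_)

  -- Apartness `x # 0#` provides an inverse of the difference `x - 0#`, which is then identified
  -- with `x`.
  inverseʳ : ∀ {x} (x#0 : x # 0#) → x * inv x x#0 ≈ 1#
  inverseʳ {x} x#0 = trans (*-congʳ (sym (x-0≈x x))) (proj₂ (proj₂ (#⇒invertible x#0)))

  *-cancelˡ-# : ∀ {x y z} → x # 0# → x * y ≈ x * z → y ≈ z
  *-cancelˡ-# {x} {y} {z} x#0 xy≈xz = begin
    y                  ≈⟨ lemma y ⟩
    x⁻¹ * (x * y)      ≈⟨ *-congˡ xy≈xz ⟩
    x⁻¹ * (x * z)      ≈⟨ lemma z ⟨
    z                  ∎
    where
    x⁻¹ = inv x x#0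
    lemma : ∀ t → t ≈ x⁻¹ * (x * t)
    lemma t = begin
      t               ≈⟨ *-identityˡ t ⟨
      1# * t          ≈⟨ *-congʳ (inverseʳ x#0) ⟨
      x * x⁻¹ * t     ≈⟨ solve 3 (λ x y t → x :* y :* t := y :* (x :* t)) refl x x⁻¹ t ⟩
      x⁻¹ * (x * t)   ∎

  inv-unique : ∀ {x y} (x#0 : x # 0#) → x * y ≈ 1# → inv x x#0 ≈ y
  inv-unique x#0 xy≈1 = *-cancelˡ-# x#0 (trans (inverseʳ x#0) (sym xy≈1))

  -- The witness `xy#0` is arbitrary, so the law applies whatever apartness proof a quotient
  -- carries.
  inv-* : ∀ {x y} (x#0 : x # 0#) (y#0 : y # 0#) (xy#0 : x * y # 0#) →
          inv (x * y) xy#0 ≈ inv x x#0 * inv y y#0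
  inv-* {x} {y} x#0 y#0 xy#0 = inv-unique xy#0 (begin
    x * y * (x⁻¹ * y⁻¹)     ≈⟨ solve 4 (λ x y z w → x :* y :* (z :* w) := x :* z :* (y :* w))
                                 refl x y x⁻¹ y⁻¹ ⟩
    x * x⁻¹ * (y * y⁻¹)     ≈⟨ *-cong (inverseʳ x#0) (inverseʳ y#0) ⟩
    1# * 1#                 ≈⟨ *-identityˡ 1# ⟩
    1#                      ∎)
    where
    x⁻¹ = inv x x#0
    y⁻¹ = inv y y#0

  opaque
    -- Summands are functions on all of ℕ, so index shifts and changes of the upper limit need no
    -- casts between `Fin` types.
    ∑ : ℕ → (ℕ → Carrier) → Carrier
    ∑ n f = sum {n} (f ∘ toℕ)

    ∑≡sum : ∀ n f → ∑ n f ≡ sum {n} (f ∘ toℕ)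
    ∑≡sum n f = ≡.refl

    ∑-zero : ∀ f → ∑ 0 f ≡ 0#
    ∑-zero f = ≡.refl

    ∑-suc : ∀ n f → ∑ (suc n) f ≡ f 0 + ∑ n (f ∘ suc)
    ∑-suc n f = ≡.refl

    ∑-cong : ∀ n {f g : ℕ → Carrier} → (∀ k → k ℕ.< n → f k ≈ g k) → ∑ n f ≈ ∑ n g
    ∑-cong n f≈g = sum-cong-≋ {n} (λ j → f≈g (toℕ j) (toℕ<n j))

    ∑-+ : ∀ n (f g : ℕ → Carrier) → ∑ n (λ k → f k + g k) ≈ ∑ n f + ∑ n g
    ∑-+ n f g = ∑-distrib-+ {n} (f ∘ toℕ) (g ∘ toℕ)

    ∑-* : ∀ n a (f : ℕ → Carrier) → ∑ n (λ k → a * f k) ≈ a * ∑ n f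
    ∑-* n a f = sym (*-distribˡ-sum {n} a (f ∘ toℕ))

    ∑-drop-last : ∀ n {f : ℕ → Carrier} → f n ≈ 0# → ∑ (suc n) f ≈ ∑ n f
    ∑-drop-last zero        f0≈0 = trans (+-identityʳ _) f0≈0
    ∑-drop-last (suc n) {f} fn≈0 = +-congˡ (∑-drop-last n {f ∘ suc} fn≈0)

  ∑-linear : ∀ n a (f g : ℕ → Carrier) → ∑ n (λ k → a * f k + g k) ≈ a * ∑ n f + ∑ n g
  ∑-linear n a f g = trans (∑-+ n (λ k → a * f k) g) (+-congʳ (∑-* n a f))

  -- Abel summation: each `g k` is collected from `f k` and `f (suc k)`. It serves to regroup a sum
  -- after T has sent each term to its two neighbours; `z` is what falls off the lower end.
  ∑-by-parts : ∀ n {f g c : ℕ → Carrier} {z} →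
               f 0 ≈ z + g 0 → (∀ k → f (suc k) ≈ g (suc k) + g k) → c (suc n) ≈ 0# →
               ∑ (suc n) (λ k → c k * f k) ≈ c 0 * z + ∑ (suc n) (λ k → (c k + c (suc k)) * g k)
  ∑-by-parts n {f} {g} {c} {z} f0 f-suc c-last = begin
    ∑ (suc n) (λ k → c k * f k)
      ≡⟨ ∑-suc n _ ⟩
    c 0 * f 0 + ∑ n (λ k → c (suc k) * f (suc k))
      ≈⟨ +-cong (trans (*-congˡ f0) (distribˡ _ _ _))
                (∑-cong n λ k _ → trans (*-congˡ (f-suc k)) (distribˡ _ _ _)) ⟩
    (c 0 * z + c 0 * g 0) + ∑ n (λ k → c (suc k) * g (suc k) + c (suc k) * g k)
      ≈⟨ +-congˡ (∑-+ n (λ k → c (suc k) * g (suc k)) (λ k → c (suc k) * g k)) ⟩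
    (c 0 * z + c 0 * g 0) + (∑ n (λ k → c (suc k) * g (suc k)) + ∑ n (λ k → c (suc k) * g k))
      ≈⟨ solve 4 (λ a b c d → (a :+ b) :+ (c :+ d) := a :+ ((b :+ c) :+ d)) refl _ _ _ _ ⟩
    c 0 * z + (c 0 * g 0 + ∑ n (λ k → c (suc k) * g (suc k)) + ∑ n (λ k → c (suc k) * g k))
      ≈⟨ +-congˡ (+-cong (reflexive (∑-suc n (λ k → c k * g k)))
           -- The shifted sum lacks its term at `k = n`; that term is zero by `c-last` and may be
           -- added.
           (∑-drop-last n {λ k → c (suc k) * g k} (trans (*-congʳ c-last) (zeroˡ _)))) ⟨
    c 0 * z + (∑ (suc n) (λ k → c k * g k) + ∑ (suc n) (λ k → c (suc k) * g k))
      ≈⟨ +-congˡ (∑-+ (suc n) (λ k → c k * g k) (λ k → c (suc k) * g k)) ⟨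
    c 0 * z + ∑ (suc n) (λ k → c k * g k + c (suc k) * g k)
      ≈⟨ +-congˡ (∑-cong (suc n) λ k _ → distribʳ (g k) (c k) (c (suc k))) ⟨
    c 0 * z + ∑ (suc n) (λ k → (c k + c (suc k)) * g k) ∎

-- Coefficients of the polynomial operations.

module PolynomialProperties {c ℓ₁ ℓ₂} (K : HeytingField c ℓ₁ ℓ₂) where

  open HeytingField K hiding (zero)
  open FieldProperties K
  open RingProperties ring using (-0#≈0#)
  open Field K
  open Polynomials K

  coeff-map : ∀ {h : Carrier → Carrier} → h 0# ≈ 0# → ∀ f i → coeff (map h f) i ≈ h (coeff f i)
  coeff-map h0≈0 []      i       = sym h0≈0
  coeff-map h0≈0 (a ∷ f) zero    = refl
  coeff-map h0≈0 (a ∷ f) (suc i) = coeff-map h0≈0 f i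

  coeff-• : ∀ a f i → coeff (a • f) i ≈ a * coeff f i
  coeff-• a = coeff-map (zeroʳ a)

  coeff-+ₚ : ∀ f g i → coeff (f +ₚ g) i ≈ coeff f i + coeff g i
  coeff-+ₚ []      g       i       = sym (+-identityˡ _)
  coeff-+ₚ (a ∷ f) []      i       = sym (+-identityʳ _)
  coeff-+ₚ (a ∷ f) (b ∷ g) zero    = refl
  coeff-+ₚ (a ∷ f) (b ∷ g) (suc i) = coeff-+ₚ f g i

  coeff--ₚ : ∀ f g i → coeff (f -ₚ g) i ≈ coeff f i - coeff g i
  coeff--ₚ f g i = trans (coeff-+ₚ f (map -_ g) i) (+-congˡ (coeff-map -0#≈0# g i))

  coeff-dilate : ∀ q f i → coeff (dilate q f) i ≈ q ^ i * coeff f i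
  coeff-dilate q []      i       = sym (zeroʳ _)
  coeff-dilate q (a ∷ f) zero    = sym (*-identityˡ a)
  coeff-dilate q (a ∷ f) (suc i) =
    trans (coeff-• q (dilate q f) i)
          (trans (*-congˡ (coeff-dilate q f i)) (sym (*-assoc _ _ _)))

  coeff-/x : ∀ f i → coeff (f /x) i ≡ coeff f (suc i)
  coeff-/x []      i = ≡.refl
  coeff-/x (a ∷ f) i = ≡.refl

  coeff-sumₚ : ∀ n (f : Fin n → Poly) i → coeff (sumₚ f) i ≈ sum (λ j → coeff (f j) i)
  coeff-sumₚ zero    f i = refl
  coeff-sumₚ (suc n) f i =
    trans (coeff-+ₚ (f zero) _ i) (+-congˡ (coeff-sumₚ n (f ∘ suc) i))

module Bailey {c ℓ₁ ℓ₂} (K : HeytingField c ℓ₁ ℓ₂)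
              (q : HeytingField.Carrier K) (q-nru : Field.NotRootOfUnity K q)
              (s : HeytingField.Carrier K)
              (s#0 : HeytingField._#_ K s (HeytingField.0# K)) where

  open HeytingField K hiding (zero)
  open FieldProperties K
  open PolynomialProperties K
  open RingProperties ring
    using (-‿distribˡ-*; -‿distribʳ-*; -‿involutive; -‿anti-homo-+; +-cancelʳ)
  open Exp semiring using (^-homo-*)
  open Field K
  open Polynomials K
  open QSeries K q q-nru
  open SetoidReasoning setoid

  -- The factors 1 - qⁿ and the reciprocals of (q;q)ₙ.

  1-q^_ : ℕ → Carrier
  1-q^ n = 1# - q ^ n

  -- Trades subtraction for addition, so that identities between such factors reduce to semiring
  -- identities.
  1-q^-+q^ : ∀ n → 1-q^ n + q ^ n ≈ 1#
  1-q^-+q^ n = trans (+-assoc _ _ _) (trans (+-congˡ (-‿inverseˡ _)) (+-identityʳ 1#))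

  1-q^#0 : ∀ n → 1-q^ (suc n) # 0#
  1-q^#0 n = x#y→x-y#0 (#-sym (q-nru n))

  1-q^0≈0 : 1-q^ 0 ≈ 0#
  1-q^0≈0 = -‿inverseʳ 1#

  -- This is (1 - x)(1 - y) = qᵐ⁺ⁿ expanded, with x = 1 - qᵐ and y = 1 - qⁿ. To avoid negation, qᵐqⁿ
  -- is added to both sides and 1 is written as (x + a)(y + b).
  1-q^-+ : ∀ m n → 1-q^ (m ℕ.+ n) + 1-q^ m * 1-q^ n ≈ 1-q^ m + 1-q^ n
  1-q^-+ m n = +-cancelʳ (q ^ m * q ^ n) _ _ (begin
    1-q^ (m ℕ.+ n) + x * y + a * b     ≈⟨ solve 3 (λ u v w → u :+ v :+ w := v :+ (u :+ w))
                                            refl _ _ _ ⟩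
    x * y + (1-q^ (m ℕ.+ n) + a * b)   ≈⟨ +-congˡ (+-congˡ (^-homo-* q m n)) ⟨
    x * y + (1-q^ (m ℕ.+ n) + q ^ (m ℕ.+ n))
                                       ≈⟨ +-congˡ (1-q^-+q^ (m ℕ.+ n)) ⟩
    x * y + 1#                         ≈⟨ +-congˡ (*-identityˡ 1#) ⟨
    x * y + 1# * 1#                    ≈⟨ +-congˡ (*-cong (1-q^-+q^ m) (1-q^-+q^ n)) ⟨
    x * y + (x + a) * (y + b)          ≈⟨ solve 4 (λ x y a b → x :* y :+ (x :+ a) :* (y :+ b)
                                            := x :* (y :+ b) :+ y :* (x :+ a) :+ a :* b)
                                            refl x y a b ⟩
    x * (y + b) + y * (x + a) + a * b  ≈⟨ +-congʳ (+-cong (*-congˡ (1-q^-+q^ n)) (*-congˡ (1-q^-+q^ m))) ⟩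
    x * 1# + y * 1# + a * b            ≈⟨ +-congʳ (+-cong (*-identityʳ x) (*-identityʳ y)) ⟩
    x + y + a * b                      ∎)
    where
    x = 1-q^ m
    y = 1-q^ n
    a = q ^ m
    b = q ^ n

  -- `product` unfolds at its first factor, whereas the new factor is the last one; it is split off
  -- by the library law for sums, read in the multiplicative monoid.
  qq-suc : ∀ n → qq (suc n) ≈ qq n * 1-q^ (suc n)
  qq-suc n = trans (product-init-last {n} (factor ∘ toℕ)) (*-cong
    (product-cong {n} λ j → reflexive (≡.cong factor (toℕ-inject₁ j)))
    (trans (reflexive (≡.cong factor (toℕ-fromℕ n))) (+-congˡ (-‿cong (*-comm (q ^ n) q)))))
    where
    open MonoidSum *-monoid using ()
      renaming (sum-init-last to product-init-last; sum-cong-≋ to product-cong)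
    factor : ℕ → Carrier
    factor k = 1# - q ^ k * q

  opaque
    1/qq : ℕ → Carrier
    1/qq n = inv (qq n) (qq#0 n)

    inv≡1/qq : ∀ n → inv (qq n) (qq#0 n) ≡ 1/qq n
    inv≡1/qq n = ≡.refl

    1/qq-0 : 1/qq 0 ≈ 1#
    1/qq-0 = inv-unique (qq#0 0) (*-identityˡ 1#)

    1/qq-suc : ∀ n → 1/qq n ≈ 1-q^ (suc n) * 1/qq (suc n)
    1/qq-suc n = inv-unique (qq#0 n) (begin
      qq n * (1-q^ (suc n) * 1/qq (suc n))   ≈⟨ *-assoc _ _ _ ⟨
      qq n * 1-q^ (suc n) * 1/qq (suc n)     ≈⟨ *-congʳ (qq-suc n) ⟨
      qq (suc n) * 1/qq (suc n)              ≈⟨ inverseʳ (qq#0 (suc n)) ⟩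
      1#                                     ∎)

  -- 1/(q;q)ₙ₋ₖ with the convention 1/(q;q)₋ⱼ = 0 for j > 0, which absorbs the boundary terms.
  w : ℕ → ℕ → Carrier
  w n       zero    = 1/qq n
  w zero    (suc k) = 0#
  w (suc n) (suc k) = w n k

  w-≤ : ∀ {n k} → k ≤ n → w n k ≡ 1/qq (n ∸ k)
  w-≤ z≤n     = ≡.refl
  w-≤ (s≤s h) = w-≤ h

  w-zero : ∀ n → w n (suc n) ≡ 0#
  w-zero zero    = ≡.refl
  w-zero (suc n) = w-zero n

  -- The boundary `k = n` needs no exception: there the factor 1 - q⁰ vanishes together with the
  -- left side.
  w-suc : ∀ {n k} → k ≤ n → w n (suc k) ≈ 1-q^ (n ∸ k) * w n k
  w-suc {zero}  z≤n     = sym (trans (*-congʳ 1-q^0≈0) (zeroˡ _))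
  w-suc {suc n} z≤n     = 1/qq-suc n
  w-suc         (s≤s h) = w-suc h

  -- The coefficient identity behind both recurrences. Every term is a multiple of `W * V`, and the
  -- multipliers satisfy `1-q^-+` at the exponents `n ∸ k` and `suc b`.
  w-identity : ∀ {n k} b N → k ≤ n → (n ∸ k) ℕ.+ suc b ≡ N →
    1-q^ N * (w n k * 1/qq (suc b)) + w n (suc k) * 1/qq b ≈
    w n k * 1/qq b + w n (suc k) * 1/qq (suc b)
  w-identity {n} {k} b N k≤n ≡.refl = begin
    1-q^ N * (W * V) + w n (suc k) * 1/qq b
      ≈⟨ +-congˡ (*-cong (w-suc k≤n) (1/qq-suc b)) ⟩
    1-q^ N * (W * V) + x * W * (y * V)
      ≈⟨ solve 5 (λ p x y W V → p :* (W :* V) :+ x :* W :* (y :* V) := (p :+ x :* y) :* (W :* V))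
           refl (1-q^ N) x y W V ⟩
    (1-q^ N + x * y) * (W * V)
      ≈⟨ *-congʳ (1-q^-+ (n ∸ k) (suc b)) ⟩
    (x + y) * (W * V)
      ≈⟨ solve 4 (λ x y W V → (x :+ y) :* (W :* V) := W :* (y :* V) :+ x :* W :* V)
           refl x y W V ⟩
    W * (y * V) + x * W * V
      ≈⟨ +-cong (*-congˡ (1/qq-suc b)) (*-congʳ (w-suc k≤n)) ⟨
    W * 1/qq b + w n (suc k) * V ∎
    where
    W = w n k
    V = 1/qq (suc b)
    x = 1-q^ (n ∸ k)
    y = 1-q^ (suc b)

  -- The operator T on coefficient sequences.

  shift : (ℕ → Carrier) → ℕ → Carrier
  shift f zero    = 0#
  shift f (suc i) = f i

  -- The operator x + (q-1)(-s)D on coefficient sequences; since D xⁱ⁺¹ = [i+1] xⁱ, no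
  -- division by 1-q remains.
  T : (ℕ → Carrier) → ℕ → Carrier
  T f i = shift f i + s * (1-q^ (suc i) * f (suc i))

  T-cong : ∀ {f g : ℕ → Carrier} → (∀ i → f i ≈ g i) → ∀ i → T f i ≈ T g i
  T-cong f≈g zero    = +-congˡ (*-congˡ (*-congˡ (f≈g 1)))
  T-cong f≈g (suc i) = +-cong (f≈g i) (*-congˡ (*-congˡ (f≈g (suc (suc i)))))

  -- The form `a * f + g` covers scaling (`g` zero) and addition (`a` one), and it is the shape in
  -- which a sum unfolds.
  T-linear : ∀ a f g i → T (λ j → a * f j + g j) i ≈ a * T f i + T g i
  T-linear a f g i = begin
    shift (λ j → a * f j + g j) i + s * (p * (a * f (suc i) + g (suc i)))
      ≈⟨ +-congʳ (shift-linear i) ⟩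
    a * shift f i + shift g i + s * (p * (a * f (suc i) + g (suc i)))
      ≈⟨ solve 7 (λ a u v s p x y → a :* u :+ v :+ s :* (p :* (a :* x :+ y))
                    := a :* (u :+ s :* (p :* x)) :+ (v :+ s :* (p :* y)))
           refl a (shift f i) (shift g i) s p (f (suc i)) (g (suc i)) ⟩
    a * T f i + T g i ∎
    where
    p = 1-q^ (suc i)
    shift-linear : ∀ i → shift (λ j → a * f j + g j) i ≈ a * shift f i + shift g i
    shift-linear zero    = sym (trans (+-identityʳ _) (zeroʳ a))
    shift-linear (suc i) = refl

  T-0 : ∀ i → T (λ _ → 0#) i ≈ 0#
  T-0 i = trans (+-cong (shift-0 i) (trans (*-congˡ (zeroʳ _)) (zeroʳ s))) (+-identityˡ 0#)
    where
    shift-0 : ∀ i → shift (λ _ → 0#) i ≈ 0#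
    shift-0 zero    = refl
    shift-0 (suc i) = refl

  T-* : ∀ a f i → T (λ j → a * f j) i ≈ a * T f i
  T-* a f i = begin
    T (λ j → a * f j) i          ≈⟨ T-cong (λ j → +-identityʳ (a * f j)) i ⟨
    T (λ j → a * f j + 0#) i     ≈⟨ T-linear a f (λ _ → 0#) i ⟩
    a * T f i + T (λ _ → 0#) i   ≈⟨ +-congˡ (T-0 i) ⟩
    a * T f i + 0#               ≈⟨ +-identityʳ _ ⟩
    a * T f i                    ∎

  T-∑ : ∀ n (c : ℕ → Carrier) (f : ℕ → ℕ → Carrier) i →
        T (λ j → ∑ n (λ k → c k * f k j)) i ≈ ∑ n (λ k → c k * T (f k) i)
  T-∑ zero    c f i = begin
    T (λ j → ∑ 0 (λ k → c k * f k j)) i   ≈⟨ T-cong (λ j → reflexive (∑-zero _)) i ⟩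
    T (λ _ → 0#) i                        ≈⟨ T-0 i ⟩
    0#                                    ≡⟨ ∑-zero _ ⟨
    ∑ 0 (λ k → c k * T (f k) i)           ∎
  T-∑ (suc n) c f i = begin
    T (λ j → ∑ (suc n) (λ k → c k * f k j)) i
      ≈⟨ T-cong (λ j → reflexive (∑-suc n _)) i ⟩
    T (λ j → c 0 * f 0 j + ∑ n (λ k → c (suc k) * f (suc k) j)) i
      ≈⟨ T-linear (c 0) (f 0) (λ j → ∑ n (λ k → c (suc k) * f (suc k) j)) i ⟩
    c 0 * T (f 0) i + T (λ j → ∑ n (λ k → c (suc k) * f (suc k) j)) i
      ≈⟨ +-congˡ (T-∑ n (c ∘ suc) (f ∘ suc) i) ⟩
    c 0 * T (f 0) i + ∑ n (λ k → c (suc k) * T (f (suc k)) i)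
      ≡⟨ ∑-suc n _ ⟨
    ∑ (suc n) (λ k → c k * T (f k) i) ∎

  -- Agreement of T with the operator on polynomials.

  x+[q-1]-sD : Poly → Poly
  x+[q-1]-sD = x+[q-1] (- s) D

  coeff-x· : ∀ f i → coeff (x· f) i ≡ shift (coeff f) i
  coeff-x· f zero    = ≡.refl
  coeff-x· f (suc i) = ≡.refl

  [q-1]*-s : (q - 1#) * (- s) ≈ s * (1# - q)
  [q-1]*-s = begin
    (q - 1#) * (- s)     ≈⟨ -‿distribʳ-* _ _ ⟨
    - ((q - 1#) * s)     ≈⟨ -‿distribˡ-* _ _ ⟩
    - (q - 1#) * s       ≈⟨ *-congʳ (-‿anti-homo-+ q (- 1#)) ⟩
    (- - 1# - q) * s     ≈⟨ *-congʳ (+-congʳ (-‿involutive 1#)) ⟩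
    (1# - q) * s         ≈⟨ *-comm _ _ ⟩
    s * (1# - q)         ∎

  -- The factor 1 - q clears the denominator of `D`; in the operator it is supplied by `[q-1]*-s`.
  coeff-D : ∀ f i → (1# - q) * coeff (D f) i ≈ 1-q^ (suc i) * coeff f (suc i)
  coeff-D f i = begin
    (1# - q) * coeff (D f) i
      ≈⟨ *-congˡ (coeff-• _ ((f -ₚ dilate q f) /x) i) ⟩
    (1# - q) * (inv (1# - q) 1-q#0 * coeff ((f -ₚ dilate q f) /x) i)
      ≈⟨ *-assoc _ _ _ ⟨
    (1# - q) * inv (1# - q) 1-q#0 * coeff ((f -ₚ dilate q f) /x) i
      ≈⟨ *-cong (inverseʳ 1-q#0) (reflexive (coeff-/x (f -ₚ dilate q f) i)) ⟩
    1# * coeff (f -ₚ dilate q f) (suc i)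
      ≈⟨ *-identityˡ _ ⟩
    coeff (f -ₚ dilate q f) (suc i)
      ≈⟨ coeff--ₚ f (dilate q f) (suc i) ⟩
    coeff f (suc i) - coeff (dilate q f) (suc i)
      ≈⟨ +-cong (sym (*-identityˡ _)) (-‿cong (coeff-dilate q f (suc i))) ⟩
    1# * coeff f (suc i) - q ^ suc i * coeff f (suc i)
      ≈⟨ +-congˡ (-‿distribˡ-* _ _) ⟩
    1# * coeff f (suc i) + - (q ^ suc i) * coeff f (suc i)
      ≈⟨ distribʳ _ _ _ ⟨
    1-q^ (suc i) * coeff f (suc i) ∎

  coeff-x+[q-1]-sD : ∀ f i → coeff (x+[q-1]-sD f) i ≈ T (coeff f) i
  coeff-x+[q-1]-sD f i = begin
    coeff (x+[q-1]-sD f) i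
      ≈⟨ coeff-+ₚ (x· f) (((q - 1#) * (- s)) • D f) i ⟩
    coeff (x· f) i + coeff (((q - 1#) * (- s)) • D f) i
      ≈⟨ +-cong (reflexive (coeff-x· f i)) (coeff-• _ (D f) i) ⟩
    shift (coeff f) i + (q - 1#) * (- s) * coeff (D f) i
      ≈⟨ +-congˡ (trans (*-congʳ [q-1]*-s) (*-assoc _ _ _)) ⟩
    shift (coeff f) i + s * ((1# - q) * coeff (D f) i)
      ≈⟨ +-congˡ (*-congˡ (coeff-D f i)) ⟩
    T (coeff f) i ∎

  -- Substitution of the operator into a polynomial.

  eval : Poly → ℕ → Carrier
  eval p = coeff ((p ⟨ x+[q-1]-sD ⟩) (const 1#))

  δ : ℕ → ℕ → Carrier
  δ n = coeff (x^ n)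

  eval-∷ : ∀ a p i → eval (a ∷ p) i ≈ a * δ 0 i + T (eval p) i
  eval-∷ a p i = trans (coeff-+ₚ (a • const 1#) (x+[q-1]-sD ((p ⟨ x+[q-1]-sD ⟩) (const 1#))) i)
    (+-cong (coeff-• a (const 1#) i) (coeff-x+[q-1]-sD ((p ⟨ x+[q-1]-sD ⟩) (const 1#)) i))

  eval-const : ∀ a i → eval (const a) i ≈ a * δ 0 i
  eval-const a i = trans (eval-∷ a [] i) (trans (+-congˡ (T-0 i)) (+-identityʳ _))

  eval-x· : ∀ p i → eval (x· p) i ≈ T (eval p) i
  eval-x· p i = trans (eval-∷ 0# p i) (trans (+-congʳ (zeroˡ _)) (+-identityˡ _))

  eval-• : ∀ a p i → eval (a • p) i ≈ a * eval p i
  eval-• a []      i = sym (zeroʳ a)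
  eval-• a (b ∷ p) i = begin
    eval (a • (b ∷ p)) i              ≈⟨ eval-∷ (a * b) (a • p) i ⟩
    a * b * δ 0 i + T (eval (a • p)) i
      ≈⟨ +-cong (*-assoc _ _ _) (trans (T-cong (eval-• a p) i) (T-* a (eval p) i)) ⟩
    a * (b * δ 0 i) + a * T (eval p) i  ≈⟨ distribˡ _ _ _ ⟨
    a * (b * δ 0 i + T (eval p) i)    ≈⟨ *-congˡ (eval-∷ b p i) ⟨
    a * eval (b ∷ p) i                ∎

  eval-+ₚ : ∀ p r i → eval (p +ₚ r) i ≈ eval p i + eval r i
  eval-+ₚ []      r       i = sym (+-identityˡ _)
  eval-+ₚ (a ∷ p) []      i = sym (+-identityʳ _)
  eval-+ₚ (a ∷ p) (b ∷ r) i = begin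
    eval (a + b ∷ p +ₚ r) i                  ≈⟨ eval-∷ (a + b) (p +ₚ r) i ⟩
    (a + b) * δ 0 i + T (eval (p +ₚ r)) i
      -- A factor `1#` is inserted to reach the shape required by `T-linear`.
      ≈⟨ +-congˡ (T-cong (λ j → trans (eval-+ₚ p r j) (+-congʳ (sym (*-identityˡ _)))) i) ⟩
    (a + b) * δ 0 i + T (λ j → 1# * eval p j + eval r j) i
      ≈⟨ +-congˡ (trans (T-linear 1# (eval p) (eval r) i) (+-congʳ (*-identityˡ _))) ⟩
    (a + b) * δ 0 i + (T (eval p) i + T (eval r) i)
      ≈⟨ solve 5 (λ a b d x y → (a :+ b) :* d :+ (x :+ y) := (a :* d :+ x) :+ (b :* d :+ y))
           refl a b (δ 0 i) (T (eval p) i) (T (eval r) i) ⟩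
    (a * δ 0 i + T (eval p) i) + (b * δ 0 i + T (eval r) i)
      ≈⟨ +-cong (eval-∷ a p i) (eval-∷ b r i) ⟨
    eval (a ∷ p) i + eval (b ∷ r) i          ∎

  -- The action of T on q-Lucas polynomials and on powers of x.

  L : ℕ → ℕ → Carrier
  L n = coeff (qLucas n (- s))

  -- The classical Lucas recurrence with parameter `- s` survives substitution, because substitution
  -- is linear and turns multiplication by x into T.
  T-L : ∀ n i → T (L (suc n)) i ≈ L (suc (suc n)) i + s * L n i
  T-L n i = sym (begin
    L (suc (suc n)) i + s * L n i
      ≈⟨ +-congʳ (eval-+ₚ (x· lucas (suc n) (- s)) (- s • lucas n (- s)) i) ⟩
    eval (x· lucas (suc n) (- s)) i + eval (- s • lucas n (- s)) i + s * L n i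
      ≈⟨ +-congʳ (+-cong (eval-x· (lucas (suc n) (- s)) i) (eval-• (- s) (lucas n (- s)) i)) ⟩
    T (L (suc n)) i + - s * L n i + s * L n i
      ≈⟨ +-assoc _ _ _ ⟩
    T (L (suc n)) i + (- s * L n i + s * L n i)
      ≈⟨ +-congˡ (trans (sym (distribʳ _ _ _)) (trans (*-congʳ (-‿inverseˡ s)) (zeroˡ _))) ⟩
    T (L (suc n)) i + 0#
      ≈⟨ +-identityʳ _ ⟩
    T (L (suc n)) i ∎)

  opaque
    L* : ℕ → ℕ → Carrier
    L* n = coeff (qLucas* n (- s))

    coeff-qLucas* : ∀ n i → coeff (qLucas* n (- s)) i ≡ L* n i
    coeff-qLucas* n i = ≡.refl

    T-L*-0 : ∀ i → T (L* 0) i ≈ L* 1 i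
    T-L*-0 i = sym (trans (eval-x· (const 1#) i)
                          (T-cong (λ j → trans (eval-const 1# j) (*-identityˡ _)) i))

    -- The recurrence produces L₀ = 2, which is twice L*₀ = 1.
    T-L*-1 : ∀ i → T (L* 1) i ≈ L* 2 i + s * (L* 0 i + L* 0 i)
    T-L*-1 i = trans (T-L 0 i) (+-congˡ (*-congˡ (trans (eval-const _ i)
      (trans (distribʳ _ _ _) (+-cong (*-identityˡ _) (*-identityˡ _))))))

    T-L*-suc-suc : ∀ n i →
      T (L* (suc (suc n))) i ≈ L* (suc (suc (suc n))) i + s * L* (suc n) i
    T-L*-suc-suc n = T-L (suc n)

  -- D xⁿ = [n] xⁿ⁻¹, with the index of q moved from the exponent to the coefficient.
  1-q^-δ : ∀ n i → 1-q^ (suc i) * δ n i ≈ 1-q^ (suc n) * δ n i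
  1-q^-δ n i = trans (distribʳ _ _ _) (trans (+-congˡ (begin
    - (q * q ^ i) * δ n i     ≈⟨ -‿distribˡ-* _ _ ⟨
    - (q * q ^ i * δ n i)     ≈⟨ -‿cong (trans (*-assoc _ _ _)
                                   (trans (*-congˡ (q^-δ n i)) (sym (*-assoc _ _ _)))) ⟩
    - (q * q ^ n * δ n i)     ≈⟨ -‿distribˡ-* _ _ ⟩
    - (q * q ^ n) * δ n i     ∎)) (sym (distribʳ _ _ _)))
    where
    q^-δ : ∀ n i → q ^ i * δ n i ≈ q ^ n * δ n i
    q^-δ zero    zero    = refl
    q^-δ zero    (suc i) = trans (zeroʳ _) (sym (zeroʳ _))
    q^-δ (suc n) zero    = trans (zeroʳ _) (sym (zeroʳ _))
    q^-δ (suc n) (suc i) =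
      trans (*-assoc _ _ _) (trans (*-congˡ (q^-δ n i)) (sym (*-assoc _ _ _)))

  T-δ : ∀ n i → T (δ (suc n)) i ≈ δ (suc (suc n)) i + s * (1-q^ (suc n) * δ n i)
  T-δ n i = +-cong (reflexive (≡.sym (coeff-x· (x^ suc n) i))) (*-congˡ (1-q^-δ n i))

  T-δ₀ : ∀ i → T (δ 0) i ≈ δ 1 i
  T-δ₀ i = trans (+-cong (reflexive (≡.sym (coeff-x· (x^ 0) i)))
                         (trans (*-congˡ (zeroʳ _)) (zeroʳ s)))
                 (+-identityʳ _)

  -- Powers of 1/s and even indices.

  opaque
    s⁻ : ℕ → Carrier
    s⁻ n = inv (s ^ n) (^#0 s#0 n)

    inv≡s⁻ : ∀ n → inv (s ^ n) (^#0 s#0 n) ≡ s⁻ n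
    inv≡s⁻ n = ≡.refl

    s⁻-suc : ∀ n → s * s⁻ (suc n) ≈ s⁻ n
    s⁻-suc n = sym (inv-unique (^#0 s#0 n) (begin
      s ^ n * (s * s⁻ (suc n))   ≈⟨ solve 3 (λ x y z → x :* (y :* z) := y :* x :* z) refl _ _ _ ⟩
      s * s ^ n * s⁻ (suc n)     ≈⟨ inverseʳ (^#0 s#0 (suc n)) ⟩
      1#                         ∎))

  -- Each step unfolds to two successors, so the recurrences in n apply without rewriting the index.
  double : ℕ → ℕ
  double zero    = 0
  double (suc n) = suc (suc (double n))

  n+n≡double : ∀ n → n ℕ.+ n ≡ double n
  n+n≡double zero    = ≡.refl
  n+n≡double (suc n) = ≡.cong suc (≡.trans (ℕ.+-suc n n) (≡.cong suc (n+n≡double n)))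

  2*n≡double : ∀ n → 2 ℕ.* n ≡ double n
  2*n≡double n = ≡.trans (≡.cong (n ℕ.+_) (ℕ.+-identityʳ n)) (n+n≡double n)

  -- The two candidate pairs, with subscript m, and the action of T on them.

  α₀ α₁ β₀ β₁ : ℕ → ℕ → Carrier
  α₀ n i = s⁻ n * L* (double n) i
  α₁ n i = s⁻ n * L* (suc (double n)) i
  β₀ n i = s⁻ n * 1/qq (double n) * δ (double n) i
  β₁ n i = s⁻ n * 1/qq (suc (double n)) * δ (suc (double n)) i

  T-α₀-zero : ∀ i → T (α₀ 0) i ≈ α₁ 0 i
  T-α₀-zero i = trans (T-* (s⁻ 0) (L* 0) i) (*-congˡ (T-L*-0 i))

  -- Used from even to odd index: the raised term keeps its power of 1/s, while the lowered one
  -- absorbs the factor `s`.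
  s⁻-distribˡ : ∀ k x y → s⁻ (suc k) * (x + s * y) ≈ s⁻ (suc k) * x + s⁻ k * y
  s⁻-distribˡ k x y = begin
    s⁻ (suc k) * (x + s * y)
      ≈⟨ solve 4 (λ u x s y → u :* (x :+ s :* y) := u :* x :+ s :* u :* y) refl _ _ _ _ ⟩
    s⁻ (suc k) * x + s * s⁻ (suc k) * y
      ≈⟨ +-congˡ (*-congʳ (s⁻-suc k)) ⟩
    s⁻ (suc k) * x + s⁻ k * y ∎

  -- Used from odd to even index: the raised term needs one more power of 1/s, so a common `s` comes
  -- out in front.
  s⁻-factorˡ : ∀ k x y → s⁻ k * (x + s * y) ≈ s * (s⁻ (suc k) * x + s⁻ k * y)
  s⁻-factorˡ k x y = begin
    s⁻ k * (x + s * y)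
      ≈⟨ distribˡ _ _ _ ⟩
    s⁻ k * x + s⁻ k * (s * y)
      ≈⟨ +-congʳ (*-congʳ (s⁻-suc k)) ⟨
    s * s⁻ (suc k) * x + s⁻ k * (s * y)
      ≈⟨ solve 5 (λ s u x v y → s :* u :* x :+ v :* (s :* y) := s :* (u :* x :+ v :* y))
           refl _ _ _ _ _ ⟩
    s * (s⁻ (suc k) * x + s⁻ k * y) ∎

  T-α₀-suc : ∀ k i → T (α₀ (suc k)) i ≈ α₁ (suc k) i + α₁ k i
  T-α₀-suc k i =
    trans (T-* (s⁻ (suc k)) (L* (suc (suc n))) i)
          (trans (*-congˡ (T-L*-suc-suc n i)) (s⁻-distribˡ k (L* (suc (suc (suc n))) i) (L* (suc n) i)))
    where n = double k

  T-α₁-zero : ∀ i → T (α₁ 0) i ≈ s * (α₀ 1 i + (α₀ 0 i + α₀ 0 i))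
  T-α₁-zero i =
    trans (T-* (s⁻ 0) (L* 1) i)
          (trans (*-congˡ (T-L*-1 i))
                 (trans (s⁻-factorˡ 0 (L* 2 i) (L* 0 i + L* 0 i))
                        (*-congˡ (+-congˡ (distribˡ (s⁻ 0) (L* 0 i) (L* 0 i))))))

  T-α₁-suc : ∀ k i → T (α₁ (suc k)) i ≈ s * (α₀ (suc (suc k)) i + α₀ (suc k) i)
  T-α₁-suc k i =
    trans (T-* (s⁻ (suc k)) (L* (suc (suc (suc n)))) i)
          (trans (*-congˡ (T-L*-suc-suc (suc n) i))
                 (s⁻-factorˡ (suc k) (L* (suc (suc (suc (suc n)))) i) (L* (suc (suc n)) i)))
    where n = double k

  T-β₀-zero : ∀ i → T (β₀ 0) i ≈ 1-q^ 1 * β₁ 0 i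
  T-β₀-zero i = begin
    T (β₀ 0) i                                  ≈⟨ T-* (s⁻ 0 * 1/qq 0) (δ 0) i ⟩
    s⁻ 0 * 1/qq 0 * T (δ 0) i                   ≈⟨ *-cong (*-congˡ (1/qq-suc 0)) (T-δ₀ i) ⟩
    s⁻ 0 * (1-q^ 1 * 1/qq 1) * δ 1 i
      ≈⟨ solve 4 (λ u p v d → u :* (p :* v) :* d := p :* (u :* v :* d)) refl _ _ _ _ ⟩
    1-q^ 1 * β₁ 0 i ∎

  -- For the raised power the reciprocal is rewritten through the next (q;q), which leaves a factor
  -- in front; for the lowered power the factor produced by D cancels. `T-β₁` works in the same way.
  T-β₀-suc : ∀ m i → T (β₀ (suc m)) i ≈ 1-q^ (suc (double (suc m))) * β₁ (suc m) i + β₁ m i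
  T-β₀-suc m i = begin
    T (λ j → u * v₂ * δ (2 ℕ.+ n) j) i
      ≈⟨ T-* (u * v₂) (δ (2 ℕ.+ n)) i ⟩
    u * v₂ * T (δ (2 ℕ.+ n)) i
      ≈⟨ *-congˡ (T-δ (suc n) i) ⟩
    u * v₂ * (δ (3 ℕ.+ n) i + s * (1-q^ (2 ℕ.+ n) * δ (suc n) i))
      ≈⟨ solve 6 (λ u v d s p e → u :* v :* (d :+ s :* (p :* e))
                    := u :* v :* d :+ (s :* u) :* (p :* v) :* e) refl _ _ _ _ _ _ ⟩
    u * v₂ * δ (3 ℕ.+ n) i + s * u * (1-q^ (2 ℕ.+ n) * v₂) * δ (suc n) i
      ≈⟨ +-cong (*-congʳ (*-congˡ (1/qq-suc (2 ℕ.+ n))))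
                (*-congʳ (*-cong (s⁻-suc m) (sym (1/qq-suc (suc n))))) ⟩
    u * (1-q^ (3 ℕ.+ n) * 1/qq (3 ℕ.+ n)) * δ (3 ℕ.+ n) i + s⁻ m * 1/qq (suc n) * δ (suc n) i
      ≈⟨ +-congʳ (solve 4 (λ u p v d → u :* (p :* v) :* d := p :* (u :* v :* d)) refl _ _ _ _) ⟩
    1-q^ (3 ℕ.+ n) * (u * 1/qq (3 ℕ.+ n) * δ (3 ℕ.+ n) i) + s⁻ m * 1/qq (suc n) * δ (suc n) i ∎
    where
    n  = double m
    u  = s⁻ (suc m)
    v₂ = 1/qq (2 ℕ.+ n)

  T-β₁ : ∀ m i → T (β₁ m) i ≈ s * (1-q^ (double (suc m)) * β₀ (suc m) i + β₀ m i)
  T-β₁ m i = begin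
    T (λ j → u * v₁ * δ (suc n) j) i
      ≈⟨ T-* (u * v₁) (δ (suc n)) i ⟩
    u * v₁ * T (δ (suc n)) i
      ≈⟨ *-congˡ (T-δ n i) ⟩
    u * v₁ * (δ (2 ℕ.+ n) i + s * (1-q^ (suc n) * δ n i))
      ≈⟨ solve 6 (λ u v d s p e → u :* v :* (d :+ s :* (p :* e))
                    := u :* v :* d :+ s :* (u :* (p :* v) :* e)) refl _ _ _ _ _ _ ⟩
    u * v₁ * δ (2 ℕ.+ n) i + s * (u * (1-q^ (suc n) * v₁) * δ n i)
      ≈⟨ +-cong (*-congʳ (*-cong (sym (s⁻-suc m)) (1/qq-suc (suc n))))
                (*-congˡ (*-congʳ (*-congˡ (sym (1/qq-suc n))))) ⟩
    s * s⁻ (suc m) * (1-q^ (2 ℕ.+ n) * 1/qq (2 ℕ.+ n)) * δ (2 ℕ.+ n) i + s * (u * 1/qq n * δ n i)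
      ≈⟨ solve 6 (λ s t p v d b → s :* t :* (p :* v) :* d :+ s :* b
                    := s :* (p :* (t :* v :* d) :+ b)) refl _ _ _ _ _ _ ⟩
    s * (1-q^ (2 ℕ.+ n) * (s⁻ (suc m) * 1/qq (2 ℕ.+ n) * δ (2 ℕ.+ n) i) + u * 1/qq n * δ n i) ∎
    where
    n  = double m
    u  = s⁻ m
    v₁ = 1/qq (suc n)

  -- The Bailey sums and the recurrences that they satisfy under T.

  γ₀ γ₁ : ℕ → ℕ → Carrier
  γ₀ n k = w n k * 1/qq (n ℕ.+ k)
  γ₁ n k = w n k * 1/qq (suc (n ℕ.+ k))

  S₀ S₁ : ℕ → ℕ → Carrier
  S₀ n i = ∑ (suc n) (λ k → γ₀ n k * α₀ k i)
  S₁ n i = ∑ (suc n) (λ k → γ₁ n k * α₁ k i)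

  -- S₁ (n - 1), and 0 for n = 0.
  S₁⁻ : ℕ → ℕ → Carrier
  S₁⁻ n i = ∑ (suc n) (λ k → w n (suc k) * 1/qq (n ℕ.+ k) * α₁ k i)

  w-zero-* : ∀ n x → w n (suc n) * x ≈ 0#
  w-zero-* n x = trans (*-congʳ (reflexive (w-zero n))) (zeroˡ x)

  S₁⁻-zero : ∀ i → S₁⁻ 0 i ≈ 0#
  S₁⁻-zero i = begin
    S₁⁻ 0 i                              ≡⟨ ∑-suc 0 _ ⟩
    0# * 1/qq 0 * α₁ 0 i + ∑ 0 _         ≈⟨ +-cong (trans (*-congʳ (zeroˡ _)) (zeroˡ _))
                                                   (reflexive (∑-zero _)) ⟩
    0# + 0#                              ≈⟨ +-identityʳ 0# ⟩
    0#                                   ∎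

  -- The summands agree by computation, since `w (suc n) (suc k)` unfolds to `w n k`; only the extra
  -- top term has to vanish.
  S₁⁻-suc : ∀ n i → S₁⁻ (suc n) i ≈ S₁ n i
  S₁⁻-suc n i = ∑-drop-last (suc n) (trans (*-congʳ (w-zero-* n _)) (zeroˡ _))

  -- The sum of the two indices does not depend on `k`, so the factor from `w-identity` can leave
  -- the summation.
  ∸-index : ∀ {n} k → k ≤ n → (n ∸ k) ℕ.+ (n ℕ.+ k) ≡ double n
  ∸-index {n} k k≤n = ≡.trans (≡.cong ((n ∸ k) ℕ.+_) (ℕ.+-comm n k))
    (≡.trans (≡.sym (ℕ.+-assoc (n ∸ k) k n))
             (≡.trans (≡.cong (ℕ._+ n) (ℕ.m∸n+n≡m k≤n)) (n+n≡double n)))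

  -- The counterpart of the recurrence for `T (β₀ n)`. Summation by parts gives `α₁ k` the
  -- coefficient `γ₀ n k + γ₀ n (suc k)`, which `w-identity` splits between the two sums.
  T-S₀ : ∀ n i → T (S₀ n) i ≈ 1-q^ (suc (double n)) * S₁ n i + S₁⁻ n i
  T-S₀ n i = begin
    T (S₀ n) i
      ≈⟨ T-∑ (suc n) (γ₀ n) α₀ i ⟩
    ∑ (suc n) (λ k → γ₀ n k * T (α₀ k) i)
      -- Here `z` is `0#`, as T sends `α₀ 0` to `α₁ 0` alone.
      ≈⟨ ∑-by-parts n {c = γ₀ n} (trans (T-α₀-zero i) (sym (+-identityˡ _)))
           (λ k → T-α₀-suc k i) (w-zero-* n _) ⟩
    γ₀ n 0 * 0# + ∑ (suc n) (λ k → (γ₀ n k + γ₀ n (suc k)) * α₁ k i)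
      ≈⟨ trans (+-congʳ (zeroʳ _)) (+-identityˡ _) ⟩
    ∑ (suc n) (λ k → (γ₀ n k + γ₀ n (suc k)) * α₁ k i)
      ≈⟨ ∑-cong (suc n) (λ k k<n → begin
           (γ₀ n k + γ₀ n (suc k)) * α₁ k i
             ≈⟨ *-congʳ (+-congˡ (*-congˡ (reflexive (≡.cong 1/qq (ℕ.+-suc n k))))) ⟩
           (w n k * 1/qq (n ℕ.+ k) + w n (suc k) * 1/qq (suc (n ℕ.+ k))) * α₁ k i
             ≈⟨ *-congʳ (w-identity (n ℕ.+ k) _ (s≤s⁻¹ k<n) (index k (s≤s⁻¹ k<n))) ⟨
           (P * γ₁ n k + w n (suc k) * 1/qq (n ℕ.+ k)) * α₁ k i
             ≈⟨ trans (distribʳ _ _ _) (+-congʳ (*-assoc _ _ _)) ⟩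
           P * (γ₁ n k * α₁ k i) + w n (suc k) * 1/qq (n ℕ.+ k) * α₁ k i ∎) ⟩
    ∑ (suc n) (λ k → P * (γ₁ n k * α₁ k i) + w n (suc k) * 1/qq (n ℕ.+ k) * α₁ k i)
      ≈⟨ ∑-linear (suc n) P _ _ ⟩
    P * S₁ n i + S₁⁻ n i ∎
    where
    P = 1-q^ (suc (double n))
    index : ∀ k → k ≤ n → (n ∸ k) ℕ.+ suc (n ℕ.+ k) ≡ suc (double n)
    index k k≤n = ≡.trans (ℕ.+-suc (n ∸ k) (n ℕ.+ k)) (≡.cong suc (∸-index k k≤n))

  T-S₁ : ∀ n i → T (S₁ n) i ≈ s * (1-q^ (double (suc n)) * S₀ (suc n) i + S₀ n i)
  T-S₁ n i = begin
    T (S₁ n) i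
      ≈⟨ T-∑ (suc n) (γ₁ n) α₁ i ⟩
    ∑ (suc n) (λ k → γ₁ n k * T (α₁ k) i)
      ≈⟨ ∑-cong (suc n) (λ k _ → trans (*-congˡ (T-α₁ k))
           (solve 3 (λ x y z → x :* (y :* z) := y :* (x :* z)) refl _ _ _)) ⟩
    ∑ (suc n) (λ k → s * (γ₁ n k * f k))
      ≈⟨ ∑-* (suc n) s _ ⟩
    s * ∑ (suc n) (λ k → γ₁ n k * f k)
      -- The neighbours are indexed by `g k = α₀ (suc k) i`, and `z` is the doubled term
      -- `α₀ 0 i + α₀ 0 i`.
      ≈⟨ *-congˡ (∑-by-parts n {c = γ₁ n} refl (λ k → refl) (w-zero-* n _)) ⟩
    s * (γ₁ n 0 * (α₀ 0 i + α₀ 0 i) + ∑ (suc n) (λ k → (γ₁ n k + γ₁ n (suc k)) * α₀ (suc k) i))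
      ≈⟨ *-congˡ (trans (+-cong head (∑-cong (suc n) tail)) (reflexive (≡.sym (∑-suc (suc n) _)))) ⟩
    s * ∑ (2 ℕ.+ n) (λ k → P * (γ₀ (suc n) k * α₀ k i) + γ₀ n k * α₀ k i)
      ≈⟨ *-congˡ (∑-linear (2 ℕ.+ n) P _ _) ⟩
    s * (P * S₀ (suc n) i + ∑ (2 ℕ.+ n) (λ k → γ₀ n k * α₀ k i))
      -- The second sum runs one index beyond `S₀ n`; its top coefficient `γ₀ n (suc n)` is zero.
      ≈⟨ *-congˡ (+-congˡ (∑-drop-last (suc n) {λ k → γ₀ n k * α₀ k i}
           (trans (*-congʳ (w-zero-* n _)) (zeroˡ _)))) ⟩
    s * (P * S₀ (suc n) i + S₀ n i) ∎
    where
    P = 1-q^ (double (suc n))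

    f : ℕ → Carrier
    f zero    = (α₀ 0 i + α₀ 0 i) + α₀ 1 i
    f (suc k) = α₀ (suc (suc k)) i + α₀ (suc k) i

    T-α₁ : ∀ k → T (α₁ k) i ≈ s * f k
    T-α₁ zero    = trans (T-α₁-zero i) (*-congˡ (+-comm _ _))
    T-α₁ (suc k) = T-α₁-suc k i

    1/qq-n+0 : 1/qq (n ℕ.+ 0) ≈ 1/qq n
    1/qq-n+0 = reflexive (≡.cong 1/qq (ℕ.+-identityʳ n))

    1/qq-suc-n+0 : 1/qq (suc (n ℕ.+ 0)) ≈ 1/qq (suc n)
    1/qq-suc-n+0 = reflexive (≡.cong (1/qq ∘ suc) (ℕ.+-identityʳ n))

    -- At `k = 0` both terms on the right of `w-identity`, taken at `suc n` and `b = n`, equal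
    -- `1/qq n * 1/qq (suc n)`; this symmetry accounts for the doubled `α₀ 0`.
    head : γ₁ n 0 * (α₀ 0 i + α₀ 0 i) ≈ P * (γ₀ (suc n) 0 * α₀ 0 i) + γ₀ n 0 * α₀ 0 i
    head = begin
      1/qq n * 1/qq (suc (n ℕ.+ 0)) * (α₀ 0 i + α₀ 0 i)
        ≈⟨ *-congʳ (*-congˡ 1/qq-suc-n+0) ⟩
      1/qq n * 1/qq (suc n) * (α₀ 0 i + α₀ 0 i)
        ≈⟨ solve 3 (λ x y z → x :* y :* (z :+ z) := (y :* x :+ x :* y) :* z)
             refl (1/qq n) (1/qq (suc n)) (α₀ 0 i) ⟩
      (w (suc n) 0 * 1/qq n + w (suc n) 1 * 1/qq (suc n)) * α₀ 0 i
        ≈⟨ *-congʳ (w-identity n (double (suc n)) z≤n (n+n≡double (suc n))) ⟨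
      (P * (1/qq (suc n) * 1/qq (suc n)) + 1/qq n * 1/qq n) * α₀ 0 i
        ≈⟨ trans (distribʳ _ _ _) (+-congʳ (*-assoc _ _ _)) ⟩
      P * (1/qq (suc n) * 1/qq (suc n) * α₀ 0 i) + 1/qq n * 1/qq n * α₀ 0 i
        ≈⟨ +-cong (*-congˡ (*-congʳ (*-congˡ 1/qq-suc-n+0))) (*-congʳ (*-congˡ 1/qq-n+0)) ⟨
      P * (γ₀ (suc n) 0 * α₀ 0 i) + γ₀ n 0 * α₀ 0 i ∎

    index : ∀ k → k ≤ n → (n ∸ k) ℕ.+ suc (suc (n ℕ.+ k)) ≡ double (suc n)
    index k k≤n = ≡.trans (ℕ.+-suc (n ∸ k) (suc (n ℕ.+ k)))
      (≡.cong suc (≡.trans (ℕ.+-suc (n ∸ k) (n ℕ.+ k)) (≡.cong suc (∸-index k k≤n))))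

    1/qq-n+suc : ∀ k m → 1/qq (m ℕ.+ (n ℕ.+ suc k)) ≈ 1/qq (m ℕ.+ suc (n ℕ.+ k))
    1/qq-n+suc k m = reflexive (≡.cong (λ t → 1/qq (m ℕ.+ t)) (ℕ.+-suc n k))

    tail : ∀ k → k ℕ.< suc n →
      (γ₁ n k + γ₁ n (suc k)) * α₀ (suc k) i ≈
      P * (γ₀ (suc n) (suc k) * α₀ (suc k) i) + γ₀ n (suc k) * α₀ (suc k) i
    tail k k<n = begin
      (γ₁ n k + γ₁ n (suc k)) * α₀ (suc k) i
        ≈⟨ *-congʳ (+-congˡ (*-congˡ (1/qq-n+suc k 1))) ⟩
      (w n k * 1/qq (suc (n ℕ.+ k)) + w n (suc k) * 1/qq (2 ℕ.+ (n ℕ.+ k))) * α₀ (suc k) i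
        ≈⟨ *-congʳ (w-identity (suc (n ℕ.+ k)) _ (s≤s⁻¹ k<n) (index k (s≤s⁻¹ k<n))) ⟨
      (P * (w n k * 1/qq (2 ℕ.+ (n ℕ.+ k))) + w n (suc k) * 1/qq (suc (n ℕ.+ k))) * α₀ (suc k) i
        ≈⟨ trans (distribʳ _ _ _) (+-congʳ (*-assoc _ _ _)) ⟩
      P * (w n k * 1/qq (2 ℕ.+ (n ℕ.+ k)) * α₀ (suc k) i)
        + w n (suc k) * 1/qq (suc (n ℕ.+ k)) * α₀ (suc k) i
        ≈⟨ +-cong (*-congˡ (*-congʳ (*-congˡ (1/qq-n+suc k 1))))
                  (*-congʳ (*-congˡ (1/qq-n+suc k 0))) ⟨
      P * (γ₀ (suc n) (suc k) * α₀ (suc k) i) + γ₀ n (suc k) * α₀ (suc k) i ∎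

  -- Comparison of the two recurrences and passage to Bailey pairs.

  affine-cancel : ∀ {p x y u v} → p # 0# → u ≈ v → p * x + u ≈ p * y + v → x ≈ y
  affine-cancel p#0 u≈v eq =
    *-cancelˡ-# p#0 (+-cancelʳ _ _ _ (trans eq (+-congˡ (sym u≈v))))

  -- Mutual induction in the order β₀ 0, β₁ 0, β₀ 1, β₁ 1, and so on: both sides obey one two-step
  -- recurrence, whose leading factor 1 - qᴺ with N ≥ 1 can be cancelled.
  β₀≈S₀ : ∀ n i → β₀ n i ≈ S₀ n i
  β₁≈S₁ : ∀ n i → β₁ n i ≈ S₁ n i

  β₀≈S₀ zero i = begin
    s⁻ 0 * 1/qq 0 * δ 0 i                     ≈⟨ *-congʳ (*-congˡ (*-identityˡ _)) ⟨
    s⁻ 0 * (1# * 1/qq 0) * δ 0 i              ≈⟨ *-congʳ (*-congˡ (*-congʳ 1/qq-0)) ⟨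
    s⁻ 0 * (1/qq 0 * 1/qq 0) * δ 0 i
      ≈⟨ solve 3 (λ s v d → s :* v :* d := v :* (s :* d)) refl _ _ _ ⟩
    1/qq 0 * 1/qq 0 * (s⁻ 0 * δ 0 i)
      -- The normalisation L*₀ = 1 = x⁰ enters here.
      ≈⟨ *-congˡ (*-congˡ (reflexive (coeff-qLucas* 0 i))) ⟩
    1/qq 0 * 1/qq 0 * α₀ 0 i                  ≈⟨ +-identityʳ _ ⟨
    1/qq 0 * 1/qq 0 * α₀ 0 i + 0#             ≈⟨ +-congˡ (reflexive (∑-zero _)) ⟨
    1/qq 0 * 1/qq 0 * α₀ 0 i + ∑ 0 _          ≡⟨ ∑-suc 0 _ ⟨
    S₀ 0 i                                    ∎
  β₀≈S₀ (suc n) i = affine-cancel (1-q^#0 (suc (double n))) (β₀≈S₀ n i) (*-cancelˡ-# s#0 (begin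
    s * (1-q^ (double (suc n)) * β₀ (suc n) i + β₀ n i)   ≈⟨ T-β₁ n i ⟨
    T (β₁ n) i                                            ≈⟨ T-cong (β₁≈S₁ n) i ⟩
    T (S₁ n) i                                            ≈⟨ T-S₁ n i ⟩
    s * (1-q^ (double (suc n)) * S₀ (suc n) i + S₀ n i)   ∎))

  -- The predecessor of `β₁ 0` counts as `0#`, in accordance with `S₁⁻ 0`.
  β₁≈S₁ zero i = affine-cancel (1-q^#0 0) (sym (S₁⁻-zero i)) (begin
    1-q^ 1 * β₁ 0 i + 0#             ≈⟨ +-identityʳ _ ⟩
    1-q^ 1 * β₁ 0 i                  ≈⟨ T-β₀-zero i ⟨
    T (β₀ 0) i                       ≈⟨ T-cong (β₀≈S₀ 0) i ⟩
    T (S₀ 0) i                       ≈⟨ T-S₀ 0 i ⟩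
    1-q^ 1 * S₁ 0 i + S₁⁻ 0 i        ∎)
  β₁≈S₁ (suc n) i = affine-cancel (1-q^#0 (double (suc n))) (trans (β₁≈S₁ n i) (sym (S₁⁻-suc n i))) (begin
    1-q^ (suc (double (suc n))) * β₁ (suc n) i + β₁ n i         ≈⟨ T-β₀-suc n i ⟨
    T (β₀ (suc n)) i                                            ≈⟨ T-cong (β₀≈S₀ (suc n)) i ⟩
    T (S₀ (suc n)) i                                            ≈⟨ T-S₀ (suc n) i ⟩
    1-q^ (suc (double (suc n))) * S₁ (suc n) i + S₁⁻ (suc n) i   ∎)

  -- Serves both parities: `a` is the index as written in the theorem, `b` the same index expressed
  -- by `double`.
  baileyPair : ∀ m (a b : ℕ → ℕ) → (∀ n → a n ≡ b n) →
    (∀ n i → s⁻ n * 1/qq (b n) * δ (b n) i ≈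
             ∑ (suc n) (λ k → w n k * 1/qq (n ℕ.+ k ℕ.+ m) * (s⁻ k * L* (b k) i))) →
    BaileyPair m
      (λ n → qLucas* (a n) (- s) ÷ s ^ n ⟦ ^#0 s#0 n ⟧)
      (λ n → (x^ (a n)) ÷ s ^ n * qq (a n) ⟦ x#0y#0→xy#0 (^#0 s#0 n) (qq#0 (a n)) ⟧)
  baileyPair m a b a≗b hyp n i = begin
    coeff ((x^ (a n)) ÷ s ^ n * qq (a n) ⟦ x#0y#0→xy#0 (^#0 s#0 n) (qq#0 (a n)) ⟧) i
      ≈⟨ coeff-• _ (x^ (a n)) i ⟩
    inv (s ^ n * qq (a n)) (x#0y#0→xy#0 (^#0 s#0 n) (qq#0 (a n))) * δ (a n) i
      ≈⟨ *-congʳ (trans (inv-* (^#0 s#0 n) (qq#0 (a n)) _)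
                        (reflexive (≡.cong₂ _*_ (inv≡s⁻ n) (inv≡1/qq (a n))))) ⟩
    s⁻ n * 1/qq (a n) * δ (a n) i
      ≡⟨ ≡.cong (λ t → s⁻ n * 1/qq t * δ t i) (a≗b n) ⟩
    s⁻ n * 1/qq (b n) * δ (b n) i
      ≈⟨ hyp n i ⟩
    ∑ (suc n) (λ k → w n k * 1/qq (n ℕ.+ k ℕ.+ m) * (s⁻ k * L* (b k) i))
      ≈⟨ ∑-cong (suc n) (λ k k<n → sym (term k (s≤s⁻¹ k<n))) ⟩
    ∑ (suc n) (λ k → coeff (summand k) i)
      ≡⟨ ∑≡sum (suc n) _ ⟩
    sum {suc n} (λ j → coeff (summand (toℕ j)) i)
      ≈⟨ coeff-sumₚ (suc n) (summand ∘ toℕ) i ⟨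
    coeff (sumₚ {suc n} (summand ∘ toℕ)) i ∎
    where
    summand : ℕ → Poly
    summand k = (qLucas* (a k) (- s) ÷ s ^ k ⟦ ^#0 s#0 k ⟧)
      ÷ qq (n ∸ k) * qq (n ℕ.+ k ℕ.+ m)
          ⟦ x#0y#0→xy#0 (qq#0 (n ∸ k)) (qq#0 (n ℕ.+ k ℕ.+ m)) ⟧

    term : ∀ k → k ≤ n →
      coeff (summand k) i ≈ w n k * 1/qq (n ℕ.+ k ℕ.+ m) * (s⁻ k * L* (b k) i)
    term k k≤n = begin
      coeff (summand k) i
        ≈⟨ coeff-• _ (qLucas* (a k) (- s) ÷ s ^ k ⟦ ^#0 s#0 k ⟧) i ⟩
      inv (qq (n ∸ k) * qq (n ℕ.+ k ℕ.+ m)) (x#0y#0→xy#0 (qq#0 (n ∸ k)) (qq#0 (n ℕ.+ k ℕ.+ m)))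
        * coeff (qLucas* (a k) (- s) ÷ s ^ k ⟦ ^#0 s#0 k ⟧) i
        ≈⟨ *-cong (inv-* (qq#0 (n ∸ k)) (qq#0 (n ℕ.+ k ℕ.+ m)) _)
                  (coeff-• _ (qLucas* (a k) (- s)) i) ⟩
      inv (qq (n ∸ k)) (qq#0 (n ∸ k)) * inv (qq (n ℕ.+ k ℕ.+ m)) (qq#0 (n ℕ.+ k ℕ.+ m))
        * (inv (s ^ k) (^#0 s#0 k) * coeff (qLucas* (a k) (- s)) i)
        ≡⟨ ≡.cong₂ _*_
             -- Within the range `k ≤ n` the extension by zero in `w` plays no part, so it is the
             -- true reciprocal.
             (≡.cong₂ _*_ (≡.trans (inv≡1/qq (n ∸ k)) (≡.sym (w-≤ k≤n))) (inv≡1/qq (n ℕ.+ k ℕ.+ m)))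
             (≡.cong₂ _*_ (inv≡s⁻ k)
               (≡.trans (coeff-qLucas* (a k) i) (≡.cong (λ t → L* t i) (a≗b k)))) ⟩
      w n k * 1/qq (n ℕ.+ k ℕ.+ m) * (s⁻ k * L* (b k) i) ∎

theorem5p1 : ∀ {c ℓ₁ ℓ₂} (K : HeytingField c ℓ₁ ℓ₂) →
    let open HeytingField K
        open Field K
        open Polynomials K
    in (q : Carrier) (q-nru : NotRootOfUnity q) (s : Carrier) (s#0 : s # 0#) →
    let open QSeries K q q-nru in
      BaileyPair 0
        (λ n → qLucas* (2 ℕ.* n) (- s) ÷ s ^ n ⟦ ^#0 s#0 n ⟧)
        (λ n → (x^ (2 ℕ.* n)) ÷ s ^ n * qq (2 ℕ.* n)
                 ⟦ x#0y#0→xy#0 (^#0 s#0 n) (qq#0 (2 ℕ.* n)) ⟧)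
      × BaileyPair 1
        (λ n → qLucas* (2 ℕ.* n ℕ.+ 1) (- s) ÷ s ^ n ⟦ ^#0 s#0 n ⟧)
        (λ n → (x^ (2 ℕ.* n ℕ.+ 1)) ÷ s ^ n * qq (2 ℕ.* n ℕ.+ 1)
                 ⟦ x#0y#0→xy#0 (^#0 s#0 n) (qq#0 (2 ℕ.* n ℕ.+ 1)) ⟧)
theorem5p1 K q q-nru s s#0 =
    baileyPair 0 (2 ℕ.*_) double 2*n≡double (λ n i →
      trans (β₀≈S₀ n i) (∑-cong (suc n) λ k _ →
        reflexive (≡.cong (λ t → w n k * 1/qq t * α₀ k i) (≡.sym (ℕ.+-identityʳ _)))))
  , baileyPair 1 (λ n → 2 ℕ.* n ℕ.+ 1) (λ n → suc (double n))
      (λ n → ≡.trans (ℕ.+-comm _ 1) (≡.cong suc (2*n≡double n))) (λ n i →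
      trans (β₁≈S₁ n i) (∑-cong (suc n) λ k _ →
        reflexive (≡.cong (λ t → w n k * 1/qq t * α₁ k i) (ℕ.+-comm 1 _))))
  where
  open HeytingField K using (_*_; reflexive; trans)
  open FieldProperties K using (∑-cong)
  open Bailey K q q-nru s s#0
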